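{- Let $x$ and $s$ be positive integers, and for $k\ge 1$ let $$F_k(x,s):=\left[x,\frac{s}{x},x^2,\frac{s}{x^2},x^3,\frac{s}{x^3},\dots,x^k,\frac{s}{x^k}\right].$$ Then, as $k\to\infty$, $F_k(x,s)$ converges to the largest root (in $z$) of the polynomial $P(x,z,s)=sz^2-((s+1)x-1)z-x$.
   Context: For positive real numbers $b_0,b_1,\dots,b_n$, the notation $[b_0,b_1,\dots,b_n]$ denotes the finite continued fraction $b_0+\cfrac{1}{b_1+\cfrac{1}{b_2+\cdots+\cfrac{1}{b_n}}}$; the partial quotients $b_i$ need not be integers. Thus $F_k(x,s)$ has $2k$ partial quotients, alternating $x^i, s/x^i$ for $i=1,\dots,k$. -}

module Defs where

open import Data.Nat.Base as ℕ using (ℕ; suc)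
import Data.Nat.Properties as ℕ
open import Data.Integer.Base as ℤ using (ℤ)
open import Data.Rational.Base as ℚ using (ℚ; 0ℚ; 1ℚ; ½)
import Data.Rational.Properties as ℚ
open import Data.Rational.Solver using (module +-*-Solver)
open import Data.List.Base using (List; []; _∷_; applyUpTo)
open import Data.List.NonEmpty.Base as List⁺ using (List⁺; _∷_)
open import Data.Product.Base using (∃; _×_; _,_; proj₁; proj₂)
open import Data.Sum.Base using (inj₁; inj₂)
open import Relation.Binary.PropositionalEquality

------------------------------------------------------------------------
-- Constructive Cauchy reals: rational Cauchy sequences with a modulus of
-- convergence, _≈_ being equality of the reals they represent

IsCauchy : (ℕ → ℚ) → Set
IsCauchy a = ∀ ε → 0ℚ ℚ.< ε →
  ∃ λ N → ∀ m n → N ℕ.≤ m → N ℕ.≤ n → ℚ.∣ a m ℚ.- a n ∣ ℚ.< ε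

record ℝ : Set where
  constructor mkℝ
  field
    seq    : ℕ → ℚ
    cauchy : IsCauchy seq

open ℝ public

infix 4 _≈_ _≤_

_≈_ : ℝ → ℝ → Set
a ≈ b = ∀ ε → 0ℚ ℚ.< ε →
  ∃ λ N → ∀ n → N ℕ.≤ n → ℚ.∣ seq a n ℚ.- seq b n ∣ ℚ.< ε

_≤_ : ℝ → ℝ → Set
a ≤ b = ∀ ε → 0ℚ ℚ.< ε →
  ∃ λ N → ∀ n → N ℕ.≤ n → seq a n ℚ.< seq b n ℚ.+ ε

private

  open +-*-Solver

  half+half : ∀ ε → ½ ℚ.* ε ℚ.+ ½ ℚ.* ε ≡ ε
  half+half ε = trans (sym (ℚ.*-distribʳ-+ ε ½ ½)) (ℚ.*-identityˡ ε)

  half-pos : ∀ {ε} → 0ℚ ℚ.< ε → 0ℚ ℚ.< ½ ℚ.* ε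
  half-pos {ε} 0<ε =
    subst (ℚ._< ½ ℚ.* ε) (ℚ.*-zeroʳ ½) (ℚ.*-monoʳ-<-pos ½ 0<ε)

  ∣p-q∣-comm : ∀ p q → ℚ.∣ p ℚ.- q ∣ ≡ ℚ.∣ q ℚ.- p ∣
  ∣p-q∣-comm p q = trans
    (cong ℚ.∣_∣ (solve 2 (λ p q → p :- q := :- (q :- p)) refl p q))
    (ℚ.∣-p∣≡∣p∣ (q ℚ.- p))

  ∣p∣≤∣p-q∣+∣q∣ : ∀ p q → ℚ.∣ p ∣ ℚ.≤ ℚ.∣ p ℚ.- q ∣ ℚ.+ ℚ.∣ q ∣
  ∣p∣≤∣p-q∣+∣q∣ p q = subst (λ r → ℚ.∣ r ∣ ℚ.≤ ℚ.∣ p ℚ.- q ∣ ℚ.+ ℚ.∣ q ∣)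
    (solve 2 (λ p q → (p :- q) :+ q := p) refl p q)
    (ℚ.∣p+q∣≤∣p∣+∣q∣ (p ℚ.- q) q)

  ∣p∣-∣q∣≤∣p-q∣ : ∀ p q → ℚ.∣ p ∣ ℚ.- ℚ.∣ q ∣ ℚ.≤ ℚ.∣ p ℚ.- q ∣
  ∣p∣-∣q∣≤∣p-q∣ p q = subst (ℚ.∣ p ∣ ℚ.- ℚ.∣ q ∣ ℚ.≤_)
    (solve 2 (λ r q → (r :+ q) :- q := r) refl ℚ.∣ p ℚ.- q ∣ ℚ.∣ q ∣)
    (ℚ.+-monoˡ-≤ (ℚ.- ℚ.∣ q ∣) (∣p∣≤∣p-q∣+∣q∣ p q))

  ∣∣p∣-∣q∣∣≤∣p-q∣ : ∀ p q → ℚ.∣ ℚ.∣ p ∣ ℚ.- ℚ.∣ q ∣ ∣ ℚ.≤ ℚ.∣ p ℚ.- q ∣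
  ∣∣p∣-∣q∣∣≤∣p-q∣ p q with ℚ.∣p∣≡p∨∣p∣≡-p (ℚ.∣ p ∣ ℚ.- ℚ.∣ q ∣)
  ... | inj₁ eq = subst (ℚ._≤ ℚ.∣ p ℚ.- q ∣) (sym eq) (∣p∣-∣q∣≤∣p-q∣ p q)
  ... | inj₂ eq = subst₂ ℚ._≤_
    (sym (trans eq (solve 2 (λ p q → :- (p :- q) := q :- p) refl ℚ.∣ p ∣ ℚ.∣ q ∣)))
    (∣p-q∣-comm q p)
    (∣p∣-∣q∣≤∣p-q∣ q p)

  fromℚ-cauchy : ∀ q → IsCauchy (λ _ → q)
  fromℚ-cauchy q ε 0<ε = 0 , λ _ _ _ _ →
    subst (ℚ._< ε) (sym (cong ℚ.∣_∣ (ℚ.+-inverseʳ q))) 0<ε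

  +-cauchy : ∀ a b → IsCauchy a → IsCauchy b → IsCauchy (λ n → a n ℚ.+ b n)
  +-cauchy a b a-cau b-cau ε 0<ε = N ℕ.⊔ M , λ m n N⊔M≤m N⊔M≤n → begin-strict
      ℚ.∣ (a m ℚ.+ b m) ℚ.- (a n ℚ.+ b n) ∣
    ≡⟨ cong ℚ.∣_∣ (solve 4 (λ p q r s → (p :+ q) :- (r :+ s) := (p :- r) :+ (q :- s))
                   refl (a m) (b m) (a n) (b n)) ⟩
      ℚ.∣ (a m ℚ.- a n) ℚ.+ (b m ℚ.- b n) ∣
    ≤⟨ ℚ.∣p+q∣≤∣p∣+∣q∣ (a m ℚ.- a n) (b m ℚ.- b n) ⟩
      ℚ.∣ a m ℚ.- a n ∣ ℚ.+ ℚ.∣ b m ℚ.- b n ∣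
    <⟨ ℚ.+-mono-<
         (a< m n (ℕ.m⊔n≤o⇒m≤o N M N⊔M≤m) (ℕ.m⊔n≤o⇒m≤o N M N⊔M≤n))
         (b< m n (ℕ.m⊔n≤o⇒n≤o N M N⊔M≤m) (ℕ.m⊔n≤o⇒n≤o N M N⊔M≤n)) ⟩
      ½ ℚ.* ε ℚ.+ ½ ℚ.* ε
    ≡⟨ half+half ε ⟩
      ε
    ∎
    where
    open ℚ.≤-Reasoning
    N  = proj₁ (a-cau (½ ℚ.* ε) (half-pos 0<ε))
    a< = proj₂ (a-cau (½ ℚ.* ε) (half-pos 0<ε))
    M  = proj₁ (b-cau (½ ℚ.* ε) (half-pos 0<ε))
    b< = proj₂ (b-cau (½ ℚ.* ε) (half-pos 0<ε))

  neg-cauchy : ∀ a → IsCauchy a → IsCauchy (λ n → ℚ.- a n)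
  neg-cauchy a a-cau ε 0<ε = proj₁ (a-cau ε 0<ε) , λ m n N≤m N≤n →
    subst (ℚ._< ε)
      (trans (∣p-q∣-comm (a m) (a n))
        (cong ℚ.∣_∣ (solve 2 (λ p q → q :- p := (:- p) :- (:- q)) refl (a m) (a n))))
      (proj₂ (a-cau ε 0<ε) m n N≤m N≤n)

  ∣∣-cauchy : ∀ a → IsCauchy a → IsCauchy (λ n → ℚ.∣ a n ∣)
  ∣∣-cauchy a a-cau ε 0<ε = proj₁ (a-cau ε 0<ε) , λ m n N≤m N≤n →
    ℚ.≤-<-trans (∣∣p∣-∣q∣∣≤∣p-q∣ (a m) (a n)) (proj₂ (a-cau ε 0<ε) m n N≤m N≤n)

  eventually-bounded : ∀ {a} → IsCauchy a →
    ∃ λ B → 0ℚ ℚ.< B × ∃ λ N → ∀ n → N ℕ.≤ n → ℚ.∣ a n ∣ ℚ.≤ B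
  eventually-bounded {a} a-cau =
    1ℚ ℚ.+ ℚ.∣ a N ∣ ,
    ℚ.+-mono-<-≤ 0<1 (ℚ.0≤∣p∣ (a N)) ,
    N , λ n N≤n → ℚ.≤-trans (∣p∣≤∣p-q∣+∣q∣ (a n) (a N))
      (ℚ.+-monoˡ-≤ ℚ.∣ a N ∣ (ℚ.<⇒≤ (a< n N N≤n ℕ.≤-refl)))
    where
    0<1 : 0ℚ ℚ.< 1ℚ
    0<1 = ℚ.positive⁻¹ 1ℚ
    N  = proj₁ (a-cau 1ℚ 0<1)
    a< = proj₂ (a-cau 1ℚ 0<1)

  divide : ∀ {C ε} → 0ℚ ℚ.< C → 0ℚ ℚ.< ε → ∃ λ δ → 0ℚ ℚ.< δ × C ℚ.* δ ≡ ε
  divide {C} {ε} 0<C 0<ε = ℚ.1/ C ℚ.* ε , 0<δ , C*δ≡ε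
    where
    instance
      C-pos : ℚ.Positive C
      C-pos = ℚ.positive 0<C
      C≢0 : ℚ.NonZero C
      C≢0 = ℚ.pos⇒nonZero C
    0<δ : 0ℚ ℚ.< ℚ.1/ C ℚ.* ε
    0<δ = ℚ.positive⁻¹ (ℚ.1/ C ℚ.* ε)
      {{ℚ.pos*pos⇒pos (ℚ.1/ C) {{ℚ.1/pos⇒pos C}} ε {{ℚ.positive 0<ε}}}}
    C*δ≡ε : C ℚ.* (ℚ.1/ C ℚ.* ε) ≡ ε
    C*δ≡ε = trans (sym (ℚ.*-assoc C (ℚ.1/ C) ε))
      (trans (cong (ℚ._* ε) (ℚ.*-inverseʳ C)) (ℚ.*-identityˡ ε))

  ∣p*q∣<C*δ : ∀ p q {C δ} → 0ℚ ℚ.< C → ℚ.∣ p ∣ ℚ.≤ C → ℚ.∣ q ∣ ℚ.< δ →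
    ℚ.∣ p ℚ.* q ∣ ℚ.< C ℚ.* δ
  ∣p*q∣<C*δ p q {C} {δ} 0<C ∣p∣≤C ∣q∣<δ = begin-strict
      ℚ.∣ p ℚ.* q ∣
    ≡⟨ ℚ.∣p*q∣≡∣p∣*∣q∣ p q ⟩
      ℚ.∣ p ∣ ℚ.* ℚ.∣ q ∣
    ≤⟨ ℚ.*-monoʳ-≤-nonNeg ℚ.∣ q ∣ {{ℚ.∣-∣-nonNeg q}} ∣p∣≤C ⟩
      C ℚ.* ℚ.∣ q ∣
    <⟨ ℚ.*-monoʳ-<-pos C {{ℚ.positive 0<C}} ∣q∣<δ ⟩
      C ℚ.* δ
    ∎
    where open ℚ.≤-Reasoning

  *-cauchy : ∀ a b → IsCauchy a → IsCauchy b → IsCauchy (λ n → a n ℚ.* b n)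
  *-cauchy a b a-cau b-cau ε 0<ε =
    let A , 0<A , K , a≤   = eventually-bounded a-cau
        B , 0<B , L , b≤   = eventually-bounded b-cau
        δ , 0<δ , [A+B]*δ≡ε = divide (ℚ.+-mono-< 0<A 0<B) 0<ε
        N , a<             = a-cau δ 0<δ
        M , b<             = b-cau δ 0<δ
    in (K ℕ.⊔ L) ℕ.⊔ (N ℕ.⊔ M) , λ m n ≤m ≤n →
      let K⊔L≤m = ℕ.m⊔n≤o⇒m≤o (K ℕ.⊔ L) (N ℕ.⊔ M) ≤m
          K⊔L≤n = ℕ.m⊔n≤o⇒m≤o (K ℕ.⊔ L) (N ℕ.⊔ M) ≤n
          N⊔M≤m = ℕ.m⊔n≤o⇒n≤o (K ℕ.⊔ L) (N ℕ.⊔ M) ≤m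
          N⊔M≤n = ℕ.m⊔n≤o⇒n≤o (K ℕ.⊔ L) (N ℕ.⊔ M) ≤n
      in begin-strict
        ℚ.∣ a m ℚ.* b m ℚ.- a n ℚ.* b n ∣
      ≡⟨ cong ℚ.∣_∣ (solve 4 (λ p q r s →
           p :* q :- r :* s := p :* (q :- s) :+ s :* (p :- r))
           refl (a m) (b m) (a n) (b n)) ⟩
        ℚ.∣ a m ℚ.* (b m ℚ.- b n) ℚ.+ b n ℚ.* (a m ℚ.- a n) ∣
      ≤⟨ ℚ.∣p+q∣≤∣p∣+∣q∣ (a m ℚ.* (b m ℚ.- b n)) (b n ℚ.* (a m ℚ.- a n)) ⟩
        ℚ.∣ a m ℚ.* (b m ℚ.- b n) ∣ ℚ.+ ℚ.∣ b n ℚ.* (a m ℚ.- a n) ∣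
      <⟨ ℚ.+-mono-<
           (∣p*q∣<C*δ (a m) (b m ℚ.- b n) 0<A (a≤ m (ℕ.m⊔n≤o⇒m≤o K L K⊔L≤m))
             (b< m n (ℕ.m⊔n≤o⇒n≤o N M N⊔M≤m) (ℕ.m⊔n≤o⇒n≤o N M N⊔M≤n)))
           (∣p*q∣<C*δ (b n) (a m ℚ.- a n) 0<B (b≤ n (ℕ.m⊔n≤o⇒n≤o K L K⊔L≤n))
             (a< m n (ℕ.m⊔n≤o⇒m≤o N M N⊔M≤m) (ℕ.m⊔n≤o⇒m≤o N M N⊔M≤n))) ⟩
        A ℚ.* δ ℚ.+ B ℚ.* δ
      ≡⟨ ℚ.*-distribʳ-+ δ A B ⟨
        (A ℚ.+ B) ℚ.* δ
      ≡⟨ [A+B]*δ≡ε ⟩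
        ε
      ∎
    where open ℚ.≤-Reasoning

fromℚ : ℚ → ℝ
fromℚ q = mkℝ (λ _ → q) (fromℚ-cauchy q)

fromℕ : ℕ → ℝ
fromℕ n = fromℚ (ℤ.+ n ℚ./ 1)

0ℝ 1ℝ : ℝ
0ℝ = fromℚ 0ℚ
1ℝ = fromℚ 1ℚ

infix  8 -_
infixl 7 _*_
infixl 6 _+_ _-_

_+_ : ℝ → ℝ → ℝ
a + b = mkℝ (λ n → seq a n ℚ.+ seq b n) (+-cauchy (seq a) (seq b) (cauchy a) (cauchy b))

_*_ : ℝ → ℝ → ℝ
a * b = mkℝ (λ n → seq a n ℚ.* seq b n) (*-cauchy (seq a) (seq b) (cauchy a) (cauchy b))

-_ : ℝ → ℝ
- a = mkℝ (λ n → ℚ.- seq a n) (neg-cauchy (seq a) (cauchy a))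

_-_ : ℝ → ℝ → ℝ
a - b = a + (- b)

∣_∣ : ℝ → ℝ
∣ a ∣ = mkℝ (λ n → ℚ.∣ seq a n ∣) (∣∣-cauchy (seq a) (cauchy a))

infix 4 _ConvergesTo_

_ConvergesTo_ : (ℕ → ℝ) → ℝ → Set
f ConvergesTo l = ∀ ε → 0ℚ ℚ.< ε →
  ∃ λ K → ∀ k → K ℕ.≤ k → ∣ f k - l ∣ ≤ fromℚ ε

IsRoot : (ℝ → ℝ) → ℝ → Set
IsRoot p z = p z ≈ 0ℝ

IsLargestRoot : (ℝ → ℝ) → ℝ → Set
IsLargestRoot p z = IsRoot p z × (∀ w → IsRoot p w → w ≤ z)

------------------------------------------------------------------------
-- Finite continued fractions; positive rational partial quotients suffice
-- for F, and positivity makes every denominator nonzero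

record ℚ⁺ : Set where
  constructor mkℚ⁺
  field
    value        : ℚ
    .{{positive}} : ℚ.Positive value

open ℚ⁺ public using (value)

infix  8 1/⁺_
infixl 7 _/⁺_
infixl 6 _+⁺_

_+⁺_ : ℚ⁺ → ℚ⁺ → ℚ⁺
mkℚ⁺ p +⁺ mkℚ⁺ q = mkℚ⁺ (p ℚ.+ q) {{ℚ.pos+pos⇒pos p q}}

1/⁺_ : ℚ⁺ → ℚ⁺
1/⁺ mkℚ⁺ p = mkℚ⁺ ((ℚ.1/ p) {{ℚ.pos⇒nonZero p}}) {{ℚ.1/pos⇒pos p}}

_/⁺_ : (m n : ℕ) .{{_ : ℕ.NonZero m}} .{{_ : ℕ.NonZero n}} → ℚ⁺
m /⁺ n = mkℚ⁺ (ℤ.+ m ℚ./ n) {{ℚ.normalize-pos m n}}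

evaluate : ℚ⁺ → List ℚ⁺ → ℚ⁺
evaluate b []       = b
evaluate b (c ∷ cs) = b +⁺ 1/⁺ evaluate c cs

continuedFraction : List⁺ ℚ⁺ → ℚ⁺
continuedFraction (b ∷ bs) = evaluate b bs

------------------------------------------------------------------------

module _ (x s : ℕ) .{{x≢0 : ℕ.NonZero x}} .{{s≢0 : ℕ.NonZero s}} where

  block : ℕ → List⁺ ℚ⁺
  block i = (x ℕ.^ i) /⁺ 1 ∷ s /⁺ (x ℕ.^ i) ∷ []
    where instance
      x^i≢0 : ℕ.NonZero (x ℕ.^ i)
      x^i≢0 = ℕ.m^n≢0 x i

  -- x, s/x, x², s/x², …, xᵏ, s/xᵏ
  partialQuotients : (k : ℕ) .{{_ : ℕ.NonZero k}} → List⁺ ℚ⁺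
  partialQuotients (suc k) = List⁺.concatMap block (1 ∷ applyUpTo (2 ℕ.+_) k)

  F : (k : ℕ) .{{_ : ℕ.NonZero k}} → ℚ
  F k = value (continuedFraction (partialQuotients k))

P : ℝ → ℝ → ℝ → ℝ
P x z s = s * (z * z) - ((s + 1ℝ) * x - 1ℝ) * z - x

{-# OPTIONS --safe #-}

-- Multiplying the partial quotients b₀, b₁, b₂, … alternately by x and 1/x
-- multiplies the value of a continued fraction by x.  Hence F (k+2) = f (F (k+1))
-- with f z = x + x z / (1 + s z).  On [x, 2x] the map f is ½-Lipschitz, so F is
-- Cauchy; and P x z s = (z - f z) (1 + s z), so its limit is a root.  It is the
-- largest one because P x w s - P x z s ≥ w - z whenever w ≥ z ≥ x.

module Submission where

open import Defs
open import Data.Nat.Base using (ℕ; suc; NonZero)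
open import Data.Product.Base using (∃; _×_)

import Data.Nat.Base as ℕ
import Data.Nat.Properties as ℕ
import Data.Nat.Tactic.RingSolver as ℕ-Solver
open import Data.Integer.Base as ℤ using ()
import Data.Integer.Properties as ℤ
open import Data.Rational.Base as ℚ using (ℚ; 0ℚ; 1ℚ; ½)
import Data.Rational.Properties as ℚ
open import Data.Rational.Solver using (module +-*-Solver)
open import Data.Rational.Unnormalised.Base as ℚᵘ using (mkℚᵘ; *≡*; *<*)
import Data.Rational.Unnormalised.Properties as ℚᵘ
open import Data.List.Base as List using (List; []; _∷_; applyUpTo)
import Data.List.Properties as List
open import Data.List.NonEmpty.Base as List⁺ using (_∷_)
open import Data.Product.Base using (_,_; proj₁; proj₂)
open import Data.Sum.Base using (inj₁; inj₂)
open import Relation.Nullary using (yes; no; contradiction)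
open import Relation.Binary.PropositionalEquality

open +-*-Solver

-- Fractions of natural numbers

ι : ℕ → ℚ
ι n = ℤ.+ n ℚ./ 1

-- In the unnormalised rationals equality is cross-multiplication, so after leaving the reduced
-- fractions the claim becomes the hypothesis on naturals.
/-*-/ : ∀ a b c d e f .{{b≢0 : NonZero b}} .{{d≢0 : NonZero d}} .{{f≢0 : NonZero f}} →
  a ℕ.* c ℕ.* f ≡ e ℕ.* (b ℕ.* d) →
  (ℤ.+ a ℚ./ b) ℚ.* (ℤ.+ c ℚ./ d) ≡ ℤ.+ e ℚ./ f
/-*-/ a (suc b) c (suc d) e (suc f) acf≡ebd = ℚ.toℚᵘ-injective (begin-equality
    ℚ.toℚᵘ ((ℤ.+ a ℚ./ suc b) ℚ.* (ℤ.+ c ℚ./ suc d))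
  ≃⟨ ℚ.toℚᵘ-homo-* (ℤ.+ a ℚ./ suc b) (ℤ.+ c ℚ./ suc d) ⟩
    ℚ.toℚᵘ (ℤ.+ a ℚ./ suc b) ℚᵘ.* ℚ.toℚᵘ (ℤ.+ c ℚ./ suc d)
  ≃⟨ ℚᵘ.*-cong (ℚ.toℚᵘ-fromℚᵘ (mkℚᵘ (ℤ.+ a) b)) (ℚ.toℚᵘ-fromℚᵘ (mkℚᵘ (ℤ.+ c) d)) ⟩
    mkℚᵘ (ℤ.+ a) b ℚᵘ.* mkℚᵘ (ℤ.+ c) d
  ≃⟨ *≡* (trans
       (cong (ℤ._* ℤ.+ suc f) (sym (ℤ.pos-* a c)))
       (trans (sym (ℤ.pos-* (a ℕ.* c) (suc f)))
         (trans (cong ℤ.+_ acf≡ebd) (ℤ.pos-* e (suc b ℕ.* suc d))))) ⟩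
    mkℚᵘ (ℤ.+ e) f
  ≃⟨ ℚ.toℚᵘ-fromℚᵘ (mkℚᵘ (ℤ.+ e) f) ⟨
    ℚ.toℚᵘ (ℤ.+ e ℚ./ suc f)
  ∎)
  where open ℚᵘ.≤-Reasoning

ι-suc : ∀ n → ι (suc n) ≡ 1ℚ ℚ.+ ι n
ι-suc n = ℚ.toℚᵘ-injective (begin-equality
    ℚ.toℚᵘ (ι (suc n))
  ≃⟨ ℚ.toℚᵘ-fromℚᵘ (mkℚᵘ (ℤ.+ suc n) 0) ⟩
    mkℚᵘ (ℤ.+ suc n) 0
  ≃⟨ *≡* (cong (ℤ._* ℤ.1ℤ) (cong (ℤ._+_ ℤ.1ℤ) (sym (ℤ.*-identityʳ (ℤ.+ n))))) ⟩
    ℚᵘ.1ℚᵘ ℚᵘ.+ mkℚᵘ (ℤ.+ n) 0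
  ≃⟨ ℚᵘ.+-congʳ ℚᵘ.1ℚᵘ (ℚ.toℚᵘ-fromℚᵘ (mkℚᵘ (ℤ.+ n) 0)) ⟨
    ℚᵘ.1ℚᵘ ℚᵘ.+ ℚ.toℚᵘ (ι n)
  ≃⟨ ℚ.toℚᵘ-homo-+ 1ℚ (ι n) ⟨
    ℚ.toℚᵘ (1ℚ ℚ.+ ι n)
  ∎)
  where open ℚᵘ.≤-Reasoning

1≤ι : ∀ n .{{_ : NonZero n}} → 1ℚ ℚ.≤ ι n
1≤ι (suc n) = subst (1ℚ ℚ.≤_) (sym (ι-suc n))
  (ℚ.+-monoʳ-≤ 1ℚ (ℚ.nonNegative⁻¹ (ι n) {{ℚ.normalize-nonNeg n 1}}))

-- The Archimedean property

p<ι[1+∣↥p∣] : ∀ p → p ℚ.< ι (suc ℤ.∣ ℚ.↥ p ∣)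
p<ι[1+∣↥p∣] p = ℚ.toℚᵘ-cancel-<
  (ℚᵘ.<-respʳ-≃ (ℚᵘ.≃-sym (ℚ.toℚᵘ-fromℚᵘ (mkℚᵘ (ℤ.+ suc ℤ.∣ ℚ.↥ p ∣) 0))) (*<* (lemma p)))
  where
  lemma : ∀ p → ℚᵘ.↥ ℚ.toℚᵘ p ℤ.* ℤ.+ 1 ℤ.< ℤ.+ suc ℤ.∣ ℚ.↥ p ∣ ℤ.* ℚᵘ.↧ ℚ.toℚᵘ p
  lemma (ℚ.mkℚ (ℤ.+ n) d _) = subst (ℤ._< ℤ.+ suc n ℤ.* ℤ.+ suc d)
    (sym (ℤ.*-identityʳ (ℤ.+ n)))
    (ℤ.+<+ (ℕ.m≤m*n (suc n) (suc d)))
  lemma (ℚ.mkℚ ℤ.-[1+ n ] d _) = ℤ.-<+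

archimedean : ∀ p {ε} → 0ℚ ℚ.< ε → ∃ λ N → p ℚ.< ι (suc N) ℚ.* ε
archimedean p {ε} 0<ε = N , subst (ℚ._< ι (suc N) ℚ.* ε) p*1/ε*ε≡p
  (ℚ.*-monoˡ-<-pos ε (p<ι[1+∣↥p∣] (p ℚ.* ℚ.1/ ε)))
  where
  instance
    ε-pos : ℚ.Positive ε
    ε-pos = ℚ.positive 0<ε
    ε≢0 : ℚ.NonZero ε
    ε≢0 = ℚ.pos⇒nonZero ε
  N = ℤ.∣ ℚ.↥ (p ℚ.* ℚ.1/ ε) ∣
  p*1/ε*ε≡p : p ℚ.* ℚ.1/ ε ℚ.* ε ≡ p
  p*1/ε*ε≡p = trans (ℚ.*-assoc p (ℚ.1/ ε) ε)
    (trans (cong (p ℚ.*_) (ℚ.*-inverseˡ ε)) (ℚ.*-identityʳ p))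

-- Convergence rates below take the form (n+1) p ≤ C; this turns them into ε-smallness, with `N`
-- depending on `C` and `ε` but not on `p`.
scaled-bound⇒< : ∀ C ε → 0ℚ ℚ.< ε → ∃ λ N → ∀ p → ι (suc N) ℚ.* p ℚ.≤ C → p ℚ.< ε
scaled-bound⇒< C ε 0<ε = N , λ p ιp≤C →
  ℚ.*-cancelˡ-<-nonNeg (ι (suc N)) {{ℚ.normalize-nonNeg (suc N) 1}}
    (ℚ.≤-<-trans ιp≤C C<ιε)
  where
  N = proj₁ (archimedean C 0<ε)
  C<ιε = proj₂ (archimedean C 0<ε)

-- Inequalities and absolute values of rationals

0<p⇒0<½p : ∀ {p} → 0ℚ ℚ.< p → 0ℚ ℚ.< ½ ℚ.* p
0<p⇒0<½p {p} 0<p = subst (ℚ._< ½ ℚ.* p) (ℚ.*-zeroʳ ½) (ℚ.*-monoʳ-<-pos ½ 0<p)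

p≤∣p∣ : ∀ p → p ℚ.≤ ℚ.∣ p ∣
p≤∣p∣ p with ℚ.≤-total 0ℚ p
... | inj₁ 0≤p = ℚ.≤-reflexive (sym (ℚ.0≤p⇒∣p∣≡p 0≤p))
... | inj₂ p≤0 = ℚ.≤-trans p≤0 (ℚ.0≤∣p∣ p)

∣p∣≤q : ∀ {p q} → p ℚ.≤ q → ℚ.- p ℚ.≤ q → ℚ.∣ p ∣ ℚ.≤ q
∣p∣≤q {p} {q} p≤q -p≤q with ℚ.∣p∣≡p∨∣p∣≡-p p
... | inj₁ eq = subst (ℚ._≤ q) (sym eq) p≤q
... | inj₂ eq = subst (ℚ._≤ q) (sym eq) -p≤q

∣p*q∣≡∣p∣*q : ∀ p q → 0ℚ ℚ.≤ q → ℚ.∣ p ℚ.* q ∣ ≡ ℚ.∣ p ∣ ℚ.* q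
∣p*q∣≡∣p∣*q p q 0≤q =
  trans (ℚ.∣p*q∣≡∣p∣*∣q∣ p q) (cong (ℚ.∣ p ∣ ℚ.*_) (ℚ.0≤p⇒∣p∣≡p 0≤q))

*-mono-≤ : ∀ {p q r t} → 0ℚ ℚ.≤ p → 0ℚ ℚ.≤ t → p ℚ.≤ q → r ℚ.≤ t → p ℚ.* r ℚ.≤ q ℚ.* t
*-mono-≤ {p} {q} {r} {t} 0≤p 0≤t p≤q r≤t = ℚ.≤-trans
  (ℚ.*-monoˡ-≤-nonNeg p {{ℚ.nonNegative 0≤p}} r≤t)
  (ℚ.*-monoʳ-≤-nonNeg t {{ℚ.nonNegative 0≤t}} p≤q)

q≤p*q : ∀ {p q} → 1ℚ ℚ.≤ p → 0ℚ ℚ.≤ q → q ℚ.≤ p ℚ.* q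
q≤p*q {p} {q} 1≤p 0≤q = subst (ℚ._≤ p ℚ.* q) (ℚ.*-identityˡ q)
  (ℚ.*-monoʳ-≤-nonNeg q {{ℚ.nonNegative 0≤q}} 1≤p)

p≤p+q : ∀ {p q} → 0ℚ ℚ.≤ q → p ℚ.≤ p ℚ.+ q
p≤p+q {p} {q} 0≤q = subst (ℚ._≤ p ℚ.+ q) (ℚ.+-identityʳ p) (ℚ.+-monoʳ-≤ p 0≤q)

p≤q⇒0≤q-p : ∀ {p q} → p ℚ.≤ q → 0ℚ ℚ.≤ q ℚ.- p
p≤q⇒0≤q-p {p} {q} p≤q =
  subst (ℚ._≤ q ℚ.- p) (ℚ.+-inverseʳ p) (ℚ.+-monoˡ-≤ (ℚ.- p) p≤q)

0≤1 : 0ℚ ℚ.≤ 1ℚ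
0≤1 = ℚ.nonNegative⁻¹ 1ℚ

-- The polynomial on rational arguments

quadratic : ℚ → ℚ → ℚ → ℚ
quadratic X S z =
  S ℚ.* (z ℚ.* z) ℚ.+ ℚ.- (((S ℚ.+ 1ℚ) ℚ.* X ℚ.+ ℚ.- 1ℚ) ℚ.* z) ℚ.+ ℚ.- X

-- The difference quotient is 1 + (S w + S z) - (S X + X), which is at least 1 because S w ≥ S X and
-- S z ≥ X.
quadratic-expanding : ∀ {X S z w} → 1ℚ ℚ.≤ X → 1ℚ ℚ.≤ S → X ℚ.≤ z → z ℚ.≤ w →
  w ℚ.- z ℚ.≤ quadratic X S w ℚ.- quadratic X S z
quadratic-expanding {X} {S} {z} {w} 1≤X 1≤S X≤z z≤w = begin
    w ℚ.- z
  ≤⟨ q≤p*q 1≤slope (p≤q⇒0≤q-p z≤w) ⟩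
    (1ℚ ℚ.+ ((S ℚ.* w ℚ.+ S ℚ.* z) ℚ.- (S ℚ.* X ℚ.+ X))) ℚ.* (w ℚ.- z)
  ≡⟨ solve 4 (λ X S z w →
       (con 1ℚ :+ ((S :* w :+ S :* z) :- (S :* X :+ X))) :* (w :- z) :=
       (S :* (w :* w) :+ :- (((S :+ con 1ℚ) :* X :+ :- con 1ℚ) :* w) :+ :- X) :-
       (S :* (z :* z) :+ :- (((S :+ con 1ℚ) :* X :+ :- con 1ℚ) :* z) :+ :- X))
       refl X S z w ⟩
    quadratic X S w ℚ.- quadratic X S z
  ∎
  where
  open ℚ.≤-Reasoning
  X≤w = ℚ.≤-trans X≤z z≤w
  0≤X = ℚ.≤-trans 0≤1 1≤X
  0≤S = ℚ.≤-trans 0≤1 1≤S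
  X≤Sz : X ℚ.≤ S ℚ.* z
  X≤Sz = ℚ.≤-trans X≤z (q≤p*q 1≤S (ℚ.≤-trans 0≤X X≤z))
  SX≤Sw : S ℚ.* X ℚ.≤ S ℚ.* w
  SX≤Sw = ℚ.*-monoˡ-≤-nonNeg S {{ℚ.nonNegative 0≤S}} X≤w
  1≤slope : 1ℚ ℚ.≤ 1ℚ ℚ.+ ((S ℚ.* w ℚ.+ S ℚ.* z) ℚ.- (S ℚ.* X ℚ.+ X))
  1≤slope = p≤p+q (p≤q⇒0≤q-p (ℚ.+-mono-≤ SX≤Sw X≤Sz))

-- Iterates of f

module Iteration
  {X S : ℚ} (1≤X : 1ℚ ℚ.≤ X) (1≤S : 1ℚ ℚ.≤ S)
  (g : ℕ → ℚ)
  (X≤g : ∀ n → X ℚ.≤ g n)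
  (g₀≤2X : g 0 ℚ.≤ X ℚ.+ X)
  -- This is g (n+1) = f (g n) with the denominator 1 + S (g n) cleared.
  (recurrence : ∀ n →
    g (suc n) ℚ.* (1ℚ ℚ.+ S ℚ.* g n) ≡ X ℚ.* (1ℚ ℚ.+ S ℚ.* g n) ℚ.+ X ℚ.* g n)
  where

  open ℚ.≤-Reasoning

  D : ℕ → ℚ
  D n = 1ℚ ℚ.+ S ℚ.* g n

  0≤X : 0ℚ ℚ.≤ X
  0≤X = ℚ.≤-trans 0≤1 1≤X

  X-pos : ℚ.Positive X
  X-pos = ℚ.positive (ℚ.<-≤-trans (ℚ.positive⁻¹ 1ℚ) 1≤X)

  0≤g : ∀ n → 0ℚ ℚ.≤ g n
  0≤g n = ℚ.≤-trans 0≤X (X≤g n)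

  1+g≤D : ∀ n → 1ℚ ℚ.+ g n ℚ.≤ D n
  1+g≤D n = ℚ.+-monoʳ-≤ 1ℚ (q≤p*q 1≤S (0≤g n))

  g≤D : ∀ n → g n ℚ.≤ D n
  g≤D n = begin
    g n           ≤⟨ p≤p+q 0≤1 ⟩
    g n ℚ.+ 1ℚ    ≡⟨ ℚ.+-comm (g n) 1ℚ ⟩
    1ℚ ℚ.+ g n    ≤⟨ 1+g≤D n ⟩
    D n           ∎

  0≤D : ∀ n → 0ℚ ℚ.≤ D n
  0≤D n = ℚ.≤-trans (0≤g n) (g≤D n)

  D-pos : ∀ n → ℚ.Positive (D n)
  D-pos n = ℚ.positive (begin-strict
    0ℚ   <⟨ ℚ.positive⁻¹ 1ℚ ⟩
    1ℚ   ≤⟨ 1≤X ⟩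
    X    ≤⟨ X≤g n ⟩
    g n  ≤⟨ g≤D n ⟩
    D n  ∎)

  -- From z ≤ 1 + S z follows f z ≤ 2X for every z ≥ 0, so `g₀≤2X` enters only at the start.
  g≤2X : ∀ n → g n ℚ.≤ X ℚ.+ X
  g≤2X ℕ.zero    = g₀≤2X
  g≤2X (suc n) = ℚ.*-cancelʳ-≤-pos (D n) {{D-pos n}} (begin
    g (suc n) ℚ.* D n            ≡⟨ recurrence n ⟩
    X ℚ.* D n ℚ.+ X ℚ.* g n      ≤⟨ ℚ.+-monoʳ-≤ (X ℚ.* D n)
                                      (ℚ.*-monoˡ-≤-nonNeg X {{ℚ.nonNegative 0≤X}} (g≤D n)) ⟩
    X ℚ.* D n ℚ.+ X ℚ.* D n      ≡⟨ ℚ.*-distribʳ-+ (D n) X X ⟨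
    (X ℚ.+ X) ℚ.* D n            ∎)

  -- The bilinear terms of a (1 + S b) - b (1 + S a) cancel, leaving a - b; hence f a - f b is X (a
  -- - b) over the product of the two denominators.
  difference : ∀ m n →
    (g (suc m) ℚ.- g (suc n)) ℚ.* (D m ℚ.* D n) ≡ (g m ℚ.- g n) ℚ.* X
  difference m n = begin-equality
      (g (suc m) ℚ.- g (suc n)) ℚ.* (D m ℚ.* D n)
    ≡⟨ solve 4 (λ p q d e → (p :- q) :* (d :* e) := (p :* d) :* e :- (q :* e) :* d)
         refl (g (suc m)) (g (suc n)) (D m) (D n) ⟩
      g (suc m) ℚ.* D m ℚ.* D n ℚ.- g (suc n) ℚ.* D n ℚ.* D m
    ≡⟨ cong₂ (λ p q → p ℚ.* D n ℚ.- q ℚ.* D m) (recurrence m) (recurrence n) ⟩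
      (X ℚ.* D m ℚ.+ X ℚ.* g m) ℚ.* D n ℚ.- (X ℚ.* D n ℚ.+ X ℚ.* g n) ℚ.* D m
    ≡⟨ solve 4 (λ X S a b →
         (X :* (con 1ℚ :+ S :* a) :+ X :* a) :* (con 1ℚ :+ S :* b) :-
         (X :* (con 1ℚ :+ S :* b) :+ X :* b) :* (con 1ℚ :+ S :* a) :=
         (a :- b) :* X)
         refl X S (g m) (g n) ⟩
      (g m ℚ.- g n) ℚ.* X
    ∎

  -- One denominator is at least 2 and the other at least X, so their product absorbs the factor X
  -- of `difference` and still leaves a 2.
  contraction : ∀ m n →
    ι 2 ℚ.* ℚ.∣ g (suc m) ℚ.- g (suc n) ∣ ℚ.≤ ℚ.∣ g m ℚ.- g n ∣
  contraction m n = ℚ.*-cancelʳ-≤-pos X {{X-pos}} (begin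
      ι 2 ℚ.* Δ′ ℚ.* X
    ≡⟨ solve 3 (λ t d X → t :* d :* X := d :* (t :* X)) refl (ι 2) Δ′ X ⟩
      Δ′ ℚ.* (ι 2 ℚ.* X)
    ≤⟨ ℚ.*-monoˡ-≤-nonNeg Δ′ {{ℚ.∣-∣-nonNeg (g (suc m) ℚ.- g (suc n))}}
         (*-mono-≤ (ℚ.nonNegative⁻¹ (ι 2)) (0≤D n) 2≤D (ℚ.≤-trans (X≤g n) (g≤D n))) ⟩
      Δ′ ℚ.* (D m ℚ.* D n)
    ≡⟨ ∣p*q∣≡∣p∣*q (g (suc m) ℚ.- g (suc n)) (D m ℚ.* D n)
         (ℚ.nonNegative⁻¹ (D m ℚ.* D n) {{ℚ.pos⇒nonNeg (D m ℚ.* D n) {{ℚ.pos*pos⇒pos (D m) {{D-pos m}} (D n) {{D-pos n}}}}}}) ⟨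
      ℚ.∣ (g (suc m) ℚ.- g (suc n)) ℚ.* (D m ℚ.* D n) ∣
    ≡⟨ cong ℚ.∣_∣ (difference m n) ⟩
      ℚ.∣ (g m ℚ.- g n) ℚ.* X ∣
    ≡⟨ ∣p*q∣≡∣p∣*q (g m ℚ.- g n) X 0≤X ⟩
      ℚ.∣ g m ℚ.- g n ∣ ℚ.* X
    ∎)
    where
    Δ′ = ℚ.∣ g (suc m) ℚ.- g (suc n) ∣
    2≤D : ι 2 ℚ.≤ D m
    2≤D = ℚ.≤-trans (ℚ.+-monoʳ-≤ 1ℚ (ℚ.≤-trans 1≤X (X≤g m))) (1+g≤D m)

  g-g≤X : ∀ m n → g m ℚ.- g n ℚ.≤ X
  g-g≤X m n = begin
    g m ℚ.- g n        ≤⟨ ℚ.+-mono-≤ (g≤2X m) (ℚ.neg-antimono-≤ (X≤g n)) ⟩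
    X ℚ.+ X ℚ.- X      ≡⟨ solve 1 (λ X → X :+ X :- X := X) refl X ⟩
    X                  ∎

  -- The linear rate 1/(k+1) is weaker than the actual 2⁻ᵏ; its inductive step is
  -- just k + 2 ≤ 2 (k + 1).
  ∣g-g∣-bound : ∀ k m n → ι (suc k) ℚ.* ℚ.∣ g (k ℕ.+ m) ℚ.- g (k ℕ.+ n) ∣ ℚ.≤ X
  ∣g-g∣-bound ℕ.zero m n = subst (ℚ._≤ X) (sym (ℚ.*-identityˡ _))
    (∣p∣≤q (g-g≤X m n)
      (subst (ℚ._≤ X) (solve 2 (λ p q → q :- p := :- (p :- q)) refl (g m) (g n)) (g-g≤X n m)))
  ∣g-g∣-bound (suc k) m n = begin
      ι (2 ℕ.+ k) ℚ.* Δ′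
    ≤⟨ ℚ.*-monoʳ-≤-nonNeg Δ′ {{ℚ.∣-∣-nonNeg (g (suc (k ℕ.+ m)) ℚ.- g (suc (k ℕ.+ n)))}} ι≤ι*2 ⟩
      ι (suc k) ℚ.* ι 2 ℚ.* Δ′
    ≡⟨ ℚ.*-assoc (ι (suc k)) (ι 2) Δ′ ⟩
      ι (suc k) ℚ.* (ι 2 ℚ.* Δ′)
    ≤⟨ ℚ.*-monoˡ-≤-nonNeg (ι (suc k)) {{ℚ.normalize-nonNeg (suc k) 1}}
         (contraction (k ℕ.+ m) (k ℕ.+ n)) ⟩
      ι (suc k) ℚ.* ℚ.∣ g (k ℕ.+ m) ℚ.- g (k ℕ.+ n) ∣
    ≤⟨ ∣g-g∣-bound k m n ⟩
      X
    ∎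
    where
    Δ′ = ℚ.∣ g (suc (k ℕ.+ m)) ℚ.- g (suc (k ℕ.+ n)) ∣
    ι≤ι*2 : ι (2 ℕ.+ k) ℚ.≤ ι (suc k) ℚ.* ι 2
    ι≤ι*2 = begin
      ι (2 ℕ.+ k)                  ≡⟨ ι-suc (suc k) ⟩
      1ℚ ℚ.+ ι (suc k)             ≤⟨ ℚ.+-monoˡ-≤ (ι (suc k)) (1≤ι (suc k)) ⟩
      ι (suc k) ℚ.+ ι (suc k)      ≡⟨ solve 1 (λ p → p :+ p := p :* con (ι 2)) refl (ι (suc k)) ⟩
      ι (suc k) ℚ.* ι 2            ∎

  g-cauchy : IsCauchy g
  g-cauchy ε 0<ε = N , λ m n N≤m N≤n → <ε ℚ.∣ g m ℚ.- g n ∣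
    -- Indices beyond N have the form N + i, so both terms arise by N applications of f from earlier
    -- terms.
    (subst₂ (λ m n → ι (suc N) ℚ.* ℚ.∣ g m ℚ.- g n ∣ ℚ.≤ X)
      (ℕ.m+[n∸m]≡n N≤m) (ℕ.m+[n∸m]≡n N≤n) (∣g-g∣-bound N (m ℕ.∸ N) (n ℕ.∸ N)))
    where
    N  = proj₁ (scaled-bound⇒< X ε 0<ε)
    <ε = proj₂ (scaled-bound⇒< X ε 0<ε)

  -- Values of the polynomial along the iterates

  quadratic-factor : ∀ n → quadratic X S (g n) ≡ (g n ℚ.- g (suc n)) ℚ.* D n
  quadratic-factor n = begin-equality
      quadratic X S (g n)
    ≡⟨ solve 3 (λ X S z →
         S :* (z :* z) :+ :- (((S :+ con 1ℚ) :* X :+ :- con 1ℚ) :* z) :+ :- X :=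
         z :* (con 1ℚ :+ S :* z) :- (X :* (con 1ℚ :+ S :* z) :+ X :* z))
         refl X S (g n) ⟩
      g n ℚ.* D n ℚ.- (X ℚ.* D n ℚ.+ X ℚ.* g n)
    ≡⟨ cong (λ p → g n ℚ.* D n ℚ.- p) (recurrence n) ⟨
      g n ℚ.* D n ℚ.- g (suc n) ℚ.* D n
    ≡⟨ solve 3 (λ p q d → p :* d :- q :* d := (p :- q) :* d) refl (g n) (g (suc n)) (D n) ⟩
      (g n ℚ.- g (suc n)) ℚ.* D n
    ∎

  Dmax : ℚ
  Dmax = 1ℚ ℚ.+ S ℚ.* (X ℚ.+ X)

  D≤Dmax : ∀ n → D n ℚ.≤ Dmax
  D≤Dmax n = ℚ.+-monoʳ-≤ 1ℚ
    (ℚ.*-monoˡ-≤-nonNeg S {{ℚ.nonNegative (ℚ.≤-trans 0≤1 1≤S)}} (g≤2X n))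

  ∣quadratic∣-bound : ∀ n → ι (suc n) ℚ.* ℚ.∣ quadratic X S (g n) ∣ ℚ.≤ X ℚ.* Dmax
  ∣quadratic∣-bound n = begin
      ι (suc n) ℚ.* ℚ.∣ quadratic X S (g n) ∣
    ≡⟨ cong (λ p → ι (suc n) ℚ.* ℚ.∣ p ∣) (quadratic-factor n) ⟩
      ι (suc n) ℚ.* ℚ.∣ (g n ℚ.- g (suc n)) ℚ.* D n ∣
    ≡⟨ cong (ι (suc n) ℚ.*_) (∣p*q∣≡∣p∣*q (g n ℚ.- g (suc n)) (D n) (0≤D n)) ⟩
      ι (suc n) ℚ.* (ℚ.∣ g n ℚ.- g (suc n) ∣ ℚ.* D n)
    ≡⟨ ℚ.*-assoc (ι (suc n)) _ (D n) ⟨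
      ι (suc n) ℚ.* ℚ.∣ g n ℚ.- g (suc n) ∣ ℚ.* D n
    -- The starting indices 0 and 1 specialise the Cauchy rate to consecutive terms.
    ≤⟨ ℚ.*-monoʳ-≤-nonNeg (D n) {{ℚ.nonNegative (0≤D n)}}
         (subst₂ (λ i j → ι (suc n) ℚ.* ℚ.∣ g i ℚ.- g j ∣ ℚ.≤ X)
           (ℕ.+-identityʳ n) (ℕ.+-comm n 1) (∣g-g∣-bound n 0 1)) ⟩
      X ℚ.* D n
    ≤⟨ ℚ.*-monoˡ-≤-nonNeg X {{ℚ.nonNegative 0≤X}} (D≤Dmax n) ⟩
      X ℚ.* Dmax
    ∎

  quadratic-vanishes : ∀ ε → 0ℚ ℚ.< ε →
    ∃ λ N → ∀ n → N ℕ.≤ n → ℚ.∣ quadratic X S (g n) ∣ ℚ.< ε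
  quadratic-vanishes ε 0<ε = N , λ n N≤n → <ε _ (begin
      ι (suc N) ℚ.* ℚ.∣ quadratic X S (g n) ∣
    ≤⟨ ℚ.*-monoʳ-≤-nonNeg _ {{ℚ.∣-∣-nonNeg (quadratic X S (g n))}} (ι-mono-≤ (ℕ.s≤s N≤n)) ⟩
      ι (suc n) ℚ.* ℚ.∣ quadratic X S (g n) ∣
    ≤⟨ ∣quadratic∣-bound n ⟩
      X ℚ.* Dmax
    ∎)
    where
    N  = proj₁ (scaled-bound⇒< (X ℚ.* Dmax) ε 0<ε)
    <ε = proj₂ (scaled-bound⇒< (X ℚ.* Dmax) ε 0<ε)
    ι-mono-≤ : ∀ {m n} → m ℕ.≤ n → ι m ℚ.≤ ι n
    ι-mono-≤ {n = n} ℕ.z≤n = ℚ.nonNegative⁻¹ (ι n) {{ℚ.normalize-nonNeg n 1}}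
    ι-mono-≤ {suc m} {suc n} (ℕ.s≤s m≤n) = subst₂ ℚ._≤_ (sym (ι-suc m)) (sym (ι-suc n))
      (ℚ.+-monoʳ-≤ 1ℚ (ι-mono-≤ m≤n))

  -- The terms of a sequence representing a root are only approximate roots. If w ≥ g n + ε, then
  -- `quadratic-expanding` gives ε ≤ w - g n ≤ P(w) - P(g n), which two errors below ε/2 contradict.
  almost-root-bound : ∀ n w ε →
    ℚ.∣ quadratic X S (g n) ∣ ℚ.< ½ ℚ.* ε → ℚ.∣ quadratic X S w ∣ ℚ.< ½ ℚ.* ε →
    0ℚ ℚ.< ε → w ℚ.< g n ℚ.+ ε
  almost-root-bound n w ε ∣Pg∣<½ε ∣Pw∣<½ε 0<ε with w ℚ.<? g n ℚ.+ ε
  ... | yes w<g+ε = w<g+ε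
  ... | no  w≮g+ε = contradiction ε<ε (ℚ.<-irrefl refl)
    where
    g+ε≤w : g n ℚ.+ ε ℚ.≤ w
    g+ε≤w = ℚ.≮⇒≥ w≮g+ε
    ε<ε : ε ℚ.< ε
    ε<ε = begin-strict
        ε
      ≡⟨ solve 2 (λ g e → e := g :+ e :- g) refl (g n) ε ⟩
        g n ℚ.+ ε ℚ.- g n
      ≤⟨ ℚ.+-monoˡ-≤ (ℚ.- g n) g+ε≤w ⟩
        w ℚ.- g n
      ≤⟨ quadratic-expanding 1≤X 1≤S (X≤g n) (ℚ.≤-trans (p≤p+q (ℚ.<⇒≤ 0<ε)) g+ε≤w) ⟩
        quadratic X S w ℚ.- quadratic X S (g n)
      ≤⟨ p≤∣p∣ _ ⟩
        ℚ.∣ quadratic X S w ℚ.- quadratic X S (g n) ∣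
      ≤⟨ ℚ.∣p-q∣≤∣p∣+∣q∣ (quadratic X S w) (quadratic X S (g n)) ⟩
        ℚ.∣ quadratic X S w ∣ ℚ.+ ℚ.∣ quadratic X S (g n) ∣
      <⟨ ℚ.+-mono-< ∣Pw∣<½ε ∣Pg∣<½ε ⟩
        ½ ℚ.* ε ℚ.+ ½ ℚ.* ε
      ≡⟨ solve 1 (λ e → con ½ :* e :+ con ½ :* e := e) refl ε ⟩
        ε
      ∎

-- Scaling of continued fractions

value-pos : ∀ p → ℚ.Positive (value p)
value-pos (mkℚ⁺ p {{pos}}) = ℚ.positive (ℚ.positive⁻¹ p {{pos}})

0≤value : ∀ p → 0ℚ ℚ.≤ value p
0≤value p = ℚ.<⇒≤ (ℚ.positive⁻¹ (value p) {{value-pos p}})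

1/⁺-inverse : ∀ p → value (1/⁺ p) ℚ.* value p ≡ 1ℚ
1/⁺-inverse p = ℚ.*-inverseˡ (value p) {{ℚ.pos⇒nonZero (value p) {{value-pos p}}}}

-- Reciprocals turn a factor c into 1/c; this is stated as a product to avoid dividing by c.
1/⁺-scale : ∀ c p q → value p ≡ c ℚ.* value q → c ℚ.* value (1/⁺ p) ≡ value (1/⁺ q)
1/⁺-scale c p q p≡cq = begin
    c ℚ.* p⁻¹
  ≡⟨ ℚ.*-identityʳ (c ℚ.* p⁻¹) ⟨
    c ℚ.* p⁻¹ ℚ.* 1ℚ
  ≡⟨ cong (c ℚ.* p⁻¹ ℚ.*_) (1/⁺-inverse q) ⟨
    c ℚ.* p⁻¹ ℚ.* (q⁻¹ ℚ.* value q)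
  ≡⟨ solve 4 (λ c p q r → c :* p :* (q :* r) := p :* (c :* r) :* q) refl c p⁻¹ q⁻¹ (value q) ⟩
    p⁻¹ ℚ.* (c ℚ.* value q) ℚ.* q⁻¹
  ≡⟨ cong (λ r → p⁻¹ ℚ.* r ℚ.* q⁻¹) p≡cq ⟨
    p⁻¹ ℚ.* value p ℚ.* q⁻¹
  ≡⟨ cong (ℚ._* q⁻¹) (1/⁺-inverse p) ⟩
    1ℚ ℚ.* q⁻¹
  ≡⟨ ℚ.*-identityˡ q⁻¹ ⟩
    q⁻¹
  ∎
  where
  open ≡-Reasoning
  p⁻¹ = value (1/⁺ p)
  q⁻¹ = value (1/⁺ q)

-- The recurrence for `F`

module _ (x s : ℕ) .{{x≢0 : NonZero x}} .{{s≢0 : NonZero s}} where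

  private
    x^i≢0 : ∀ i → NonZero (x ℕ.^ i)
    x^i≢0 i = ℕ.m^n≢0 x i

  X S : ℚ
  X = ι x
  S = ι s

  x^ : ℕ → ℚ⁺
  x^ i = _/⁺_ (x ℕ.^ i) 1 {{x^i≢0 i}}

  s/x^ : ℕ → ℚ⁺
  s/x^ i = _/⁺_ s (x ℕ.^ i) {{s≢0}} {{ x^i≢0 i}}

  -- `blocks i is` without its leading quotient. By computation `blocks i is` is
  -- `x^ i +⁺ 1/⁺ tail i is`, and `tail i (j ∷ js)` is `s/x^ i +⁺ 1/⁺ blocks j js`.
  tail : ℕ → List ℕ → ℚ⁺
  tail i is = evaluate (s/x^ i) (List.concat (List.map List⁺.toList (List.map (block x s) is)))

  -- Arbitrary lists of exponents are allowed, so that raising every exponent by one is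
  -- `List.map suc`.
  blocks : ℕ → List ℕ → ℚ⁺
  blocks i is = continuedFraction (List⁺.concatMap (block x s) (i ∷ is))

  x^-suc : ∀ i → value (x^ (suc i)) ≡ X ℚ.* value (x^ i)
  x^-suc i = sym (/-*-/ x 1 (x ℕ.^ i) 1 (x ℕ.^ suc i) 1 refl)

  s/x^-suc : ∀ i → value (s/x^ i) ≡ X ℚ.* value (s/x^ (suc i))
  s/x^-suc i = sym (/-*-/ x 1 s (x ℕ.^ suc i) s (x ℕ.^ i)
    {{d≢0 = x^i≢0 (suc i)}} {{f≢0 = x^i≢0 i}} (lemma x s (x ℕ.^ i)))
    where
    lemma : ∀ x s y → x ℕ.* s ℕ.* y ≡ s ℕ.* (1 ℕ.* (x ℕ.* y))
    lemma = ℕ-Solver.solve-∀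

  -- Raising the exponents multiplies each x^i by X and divides each s/x^i by X. Since every level
  -- sits under a reciprocal, the factors alternate consistently: `blocks` gains X while `tail`
  -- loses it, by mutual induction.
  blocks-scale : ∀ i is → value (blocks (suc i) (List.map suc is)) ≡ X ℚ.* value (blocks i is)
  blocks-scale i is = trans
    (cong₂ ℚ._+_ (x^-suc i)
      (sym (1/⁺-scale X (tail i is) (tail (suc i) (List.map suc is)) (tail-scale i is))))
    (sym (ℚ.*-distribˡ-+ X (value (x^ i)) (value (1/⁺ tail i is))))
    where
    tail-scale : ∀ i is → value (tail i is) ≡ X ℚ.* value (tail (suc i) (List.map suc is))
    tail-scale i []       = s/x^-suc i
    tail-scale i (j ∷ js) = trans
      (cong₂ ℚ._+_ (s/x^-suc i)
        (sym (1/⁺-scale X (blocks (suc j) (List.map suc js)) (blocks j js) (blocks-scale j js))))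
      (sym (ℚ.*-distribˡ-+ X (value (s/x^ (suc i)))
        (value (1/⁺ blocks (suc j) (List.map suc js)))))

  value-x^1 : value (x^ 1) ≡ X
  value-x^1 = cong ι (ℕ.^-identityʳ x)

  X*s/x^1≡S : X ℚ.* value (s/x^ 1) ≡ S
  X*s/x^1≡S = /-*-/ x 1 s (x ℕ.^ 1) s 1 {{d≢0 = x^i≢0 1}} (lemma x s)
    where
    lemma : ∀ x s → x ℕ.* s ℕ.* 1 ≡ s ℕ.* (1 ℕ.* (x ℕ.* 1))
    lemma = ℕ-Solver.solve-∀

  -- Behind the first block the exponents 2, 3, ... are those of `F x s (suc n)` raised by one, the
  -- form that `blocks-scale` expects.
  F-suc : ∀ n → F x s (2 ℕ.+ n) ≡
    X ℚ.+ value (1/⁺ (s/x^ 1 +⁺ 1/⁺ blocks 2 (List.map suc (applyUpTo (2 ℕ.+_) n))))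
  F-suc n = cong₂ (λ p is → p ℚ.+ value (1/⁺ (s/x^ 1 +⁺ 1/⁺ blocks 2 is)))
    value-x^1 (sym (List.map-applyUpTo (2 ℕ.+_) suc n))

  -- By scaling, the part behind the first block has value X z, so the new value is X + 1/d with d =
  -- s/x + 1/(X z), and X d z = 1 + S z.
  F-recurrence : ∀ n → let z = F x s (suc n) in
    F x s (2 ℕ.+ n) ℚ.* (1ℚ ℚ.+ S ℚ.* z) ≡ X ℚ.* (1ℚ ℚ.+ S ℚ.* z) ℚ.+ X ℚ.* z
  F-recurrence n = begin
      F x s (2 ℕ.+ n) ℚ.* (1ℚ ℚ.+ S ℚ.* z)
    ≡⟨ cong (ℚ._* (1ℚ ℚ.+ S ℚ.* z)) (F-suc n) ⟩
      (X ℚ.+ d⁻¹) ℚ.* (1ℚ ℚ.+ S ℚ.* z)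
    ≡⟨ ℚ.*-distribʳ-+ (1ℚ ℚ.+ S ℚ.* z) X d⁻¹ ⟩
      X ℚ.* (1ℚ ℚ.+ S ℚ.* z) ℚ.+ d⁻¹ ℚ.* (1ℚ ℚ.+ S ℚ.* z)
    ≡⟨ cong (λ p → X ℚ.* (1ℚ ℚ.+ S ℚ.* z) ℚ.+ d⁻¹ ℚ.* p) 1+Sz≡Xdz ⟩
      X ℚ.* (1ℚ ℚ.+ S ℚ.* z) ℚ.+ d⁻¹ ℚ.* (X ℚ.* value d ℚ.* z)
    ≡⟨ cong (X ℚ.* (1ℚ ℚ.+ S ℚ.* z) ℚ.+_)
         (solve 4 (λ e X d z → e :* (X :* d :* z) := e :* d :* (X :* z)) refl d⁻¹ X (value d) z) ⟩
      X ℚ.* (1ℚ ℚ.+ S ℚ.* z) ℚ.+ d⁻¹ ℚ.* value d ℚ.* (X ℚ.* z)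
    ≡⟨ cong (λ p → X ℚ.* (1ℚ ℚ.+ S ℚ.* z) ℚ.+ p)
         (trans (cong (ℚ._* (X ℚ.* z)) (1/⁺-inverse d)) (ℚ.*-identityˡ (X ℚ.* z))) ⟩
      X ℚ.* (1ℚ ℚ.+ S ℚ.* z) ℚ.+ X ℚ.* z
    ∎
    where
    open ≡-Reasoning
    is = applyUpTo (2 ℕ.+_) n
    Z Z′ d : ℚ⁺
    Z  = blocks 1 is
    Z′ = blocks 2 (List.map suc is)
    d  = s/x^ 1 +⁺ 1/⁺ Z′
    z d⁻¹ : ℚ
    z   = F x s (suc n)
    d⁻¹ = value (1/⁺ d)
    1+Sz≡Xdz : 1ℚ ℚ.+ S ℚ.* z ≡ X ℚ.* value d ℚ.* z
    1+Sz≡Xdz = begin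
        1ℚ ℚ.+ S ℚ.* z
      ≡⟨ cong₂ (λ p q → p ℚ.+ q ℚ.* z) (1/⁺-inverse Z) X*s/x^1≡S ⟨
        value (1/⁺ Z) ℚ.* z ℚ.+ X ℚ.* value (s/x^ 1) ℚ.* z
      ≡⟨ cong (λ p → p ℚ.* z ℚ.+ X ℚ.* value (s/x^ 1) ℚ.* z)
           (1/⁺-scale X Z′ Z (blocks-scale 1 is)) ⟨
        X ℚ.* value (1/⁺ Z′) ℚ.* z ℚ.+ X ℚ.* value (s/x^ 1) ℚ.* z
      ≡⟨ solve 4 (λ X z p q → X :* p :* z :+ X :* q :* z := X :* (q :+ p) :* z)
           refl X z (value (1/⁺ Z′)) (value (s/x^ 1)) ⟩
        X ℚ.* value d ℚ.* z
      ∎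

  X≤F : ∀ n → X ℚ.≤ F x s (suc n)
  X≤F n = subst (ℚ._≤ F x s (suc n)) value-x^1 (x^≤blocks 1 (applyUpTo (2 ℕ.+_) n))
    where
    x^≤blocks : ∀ i is → value (x^ i) ℚ.≤ value (blocks i is)
    x^≤blocks i is = p≤p+q (0≤value (1/⁺ tail i is))

  -- The value is x + x/s, and s ≥ 1.
  F₁≤2X : F x s 1 ℚ.≤ X ℚ.+ X
  F₁≤2X = ℚ.+-mono-≤ (ℚ.≤-reflexive value-x^1)
    (ℚ.*-cancelʳ-≤-pos (value (s/x^ 1)) {{value-pos (s/x^ 1)}}
      (subst₂ ℚ._≤_ (sym (1/⁺-inverse (s/x^ 1))) (sym X*s/x^1≡S) (1≤ι s)))

-- Convergence to the largest root

theorem3 : (x s : ℕ) .{{_ : NonZero x}} .{{_ : NonZero s}} →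
    ∃ λ (L : ℝ) →
    IsLargestRoot (λ z → P (fromℕ x) z (fromℕ s)) L ×
    (λ k → fromℚ (F x s (suc k))) ConvergesTo L
theorem3 x s = L , (L-root , w≤L) , F→L
  where
  g : ℕ → ℚ
  g n = F x s (suc n)

  open Iteration (1≤ι x) (1≤ι s) g (X≤F x s) (F₁≤2X x s) (F-recurrence x s)

  -- The limit is the real number represented by the rational sequence itself.
  L : ℝ
  L = mkℝ g g-cauchy

  L-root : IsRoot (λ z → P (fromℕ x) z (fromℕ s)) L
  L-root ε 0<ε = proj₁ (quadratic-vanishes ε 0<ε) , λ n N≤n →
    -- The terms of `P` at `L` compute to `quadratic` at `g n`; only the subtraction of 0 has to be
    -- removed.
    subst (λ p → ℚ.∣ p ∣ ℚ.< ε) (sym (ℚ.+-identityʳ _)) (proj₂ (quadratic-vanishes ε 0<ε) n N≤n)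

  w≤L : ∀ w → IsRoot (λ z → P (fromℕ x) z (fromℕ s)) w → w ≤ L
  w≤L w w-root ε 0<ε = N ℕ.⊔ M , λ n N⊔M≤n → almost-root-bound n (seq w n) ε
    (Pg< n (ℕ.m⊔n≤o⇒m≤o N M N⊔M≤n))
    (subst (λ p → ℚ.∣ p ∣ ℚ.< ½ ℚ.* ε) (ℚ.+-identityʳ _) (Pw< n (ℕ.m⊔n≤o⇒n≤o N M N⊔M≤n)))
    0<ε
    where
    0<½ε = 0<p⇒0<½p 0<ε
    N   = proj₁ (quadratic-vanishes (½ ℚ.* ε) 0<½ε)
    Pg< = proj₂ (quadratic-vanishes (½ ℚ.* ε) 0<½ε)
    M   = proj₁ (w-root (½ ℚ.* ε) 0<½ε)
    Pw< = proj₂ (w-root (½ ℚ.* ε) 0<½ε)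

  F→L : (λ k → fromℚ (g k)) ConvergesTo L
  -- Term n of ∣ g k - L ∣ is the distance from g k to g n, so the Cauchy index K bounds both k and
  -- n; the slack η comes from the definition of `_≤_`.
  F→L ε 0<ε = K , λ k K≤k η 0<η → K , λ n K≤n →
    ℚ.<-≤-trans (g< k n K≤k K≤n) (p≤p+q (ℚ.<⇒≤ 0<η))
    where
    K  = proj₁ (g-cauchy ε 0<ε)
    g< = proj₂ (g-cauchy ε 0<ε)
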